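{- The monoidal category $(\mathbf{Nom},\diamond,\mathbb{A})$ is right closed with internal hom given by $[-,-]_\diamond$, that is, $$\mathbf{Nom}(X\diamond Y,Z)\cong\mathbf{Nom}(X,[Y,Z]_\diamond)$$ naturally, for nominal sets $X,Y,Z$.
   Context: $\mathbb{A}$ is a countably infinite set of names and $\mathrm{Perm}\,\mathbb{A}$ the group of finite permutations of $\mathbb{A}$. A nominal set is a $\mathrm{Perm}\,\mathbb{A}$-set $X$ in which every $x\in X$ has a finite support: a finite $S\subseteq\mathbb{A}$ such that every $\pi$ fixing $S$ pointwise satisfies $\pi\cdot x=x$. Then $x$ has a least finite support $\operatorname{supp}x$. $\mathbf{Nom}$ is the category of nominal sets and equivariant maps; $S\cdot X$ denotes the copower $\coprod_{s\in S}X$ of a nominal set $X$ by a set $S$. Write $x\#y$ if $\operatorname{supp}x\cap\operatorname{supp}y=\emptyset$. $\mathbb{I}$ is the category of finite sets and injections (identified with the equivalent small category of finite subsets of $\mathbb{A}$). For a nominal set $Y$ and an arbitrary set $A$, $Y^{*A}=\{f\colon A\to Y\mid a\ne b\Rightarrow f(a)\#f(b)\}$, a $\mathrm{Perm}\,\mathbb{A}$-set with pointwise action (nominal if $A$ is finite), contravariantly functorial in $A$ along injections by precomposition. The substitution tensor on $\mathbf{Nom}$ is $X\diamond Y=\int^{A\in\mathbb{I}}\mathbf{Nom}(\mathbb{A}^{*A},X)\cdot Y^{*A}$, where $\mathbb{A}$ carries the action $\pi\cdot a=\pi(a)$; it makes $(\mathbf{Nom},\diamond,\mathbb{A})$ a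 monoidal category. Equivalently, $X\diamond Y\cong\{(x,\gamma)\mid x\in X,\gamma\in Y^{*\operatorname{supp}x}\}/\sim$ with $(\pi\cdot x,\gamma)\sim(x,\gamma\pi)$ for $\gamma\in Y^{*\operatorname{supp}(\pi\cdot x)}$, with action $\pi\cdot x[\gamma]=x[\pi\cdot\gamma]$, where $x[\gamma]$ is the class of $(x,\gamma)$. A map $f\colon Y^{*\mathbb{A}}\to Z$ is (finitely) reducible if there is a finite $A\subseteq\mathbb{A}$ such that $f=g\cdot p_A$ for some $g\colon Y^{*A}\to Z$, where $p_A\colon Y^{*\mathbb{A}}\to Y^{*A}$ is the restriction map. The internal hom is $$[Y,Z]_\diamond=\{f\colon Y^{*\mathbb{A}}\to Z\mid f\text{ is }\mathrm{Perm}\,\mathbb{A}\text{ -equivariant and finitely reducible}\},$$ a nominal set under the action $(\pi\cdot f)(\gamma)=f(\gamma\pi)$.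
   Formalization: The bijection is asserted only for nonempty Y, since it fails for Y empty (X = 1 and Z discrete with two points give 2 maps against 1); the natural comparison map is given for all X, Y, Z. -}

module Defs where

open import Algebra.Bundles using (Group)
import Data.Irrelevant as Irrelevant
open import Data.List.Base using (List; []; _∷_; _++_; map; concat)
open import Data.List.Membership.Propositional using (_∈_; _∉_; mapWith∈)
open import Data.List.Membership.Propositional.Properties
  using (∈-++⁺ˡ; ∈-++⁺ʳ; ∈-map⁺; ∈-map⁻; ∈-concat⁺)
import Data.List.Membership.DecPropositional as DecMembership
open import Data.List.Relation.Binary.Subset.Propositional using (_⊆_)
open import Data.List.Relation.Unary.Any using (here)
open import Data.List.Relation.Unary.Any.Properties using (mapWith∈⁺)
open import Data.Nat.Base using (ℕ)
import Data.Nat.Properties as ℕ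
open import Data.Product.Base using (Σ; Σ-syntax; ∃; _×_; _,_; proj₁; proj₂)
open import Data.Refinement as Refinement using (Refinement; value; value-injective)
open import Function.Base using (_∘_)
open import Function.Bundles using (Func; Injection; Inverse; _↔_; _↣_; _⇔_; mk↣; mk⇔)
open import Function.Construct.Composition using (_↔-∘_)
open import Function.Construct.Identity using (↔-id)
open import Function.Construct.Symmetry using (↔-sym)
open import Function.Properties.Inverse using (↔⇒↣)
open import Level using (Level; 0ℓ; _⊔_) renaming (suc to lsuc)
open import Relation.Binary.Bundles using (Setoid)
open import Relation.Binary.Core using (Rel)
import Relation.Binary.Construct.Closure.Equivalence as EqC
open import Relation.Binary.Construct.Closure.ReflexiveTransitive using (ε; _◅_; _◅◅_)
open import Relation.Binary.Construct.Closure.Symmetric using (fwd; bwd)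
open import Relation.Binary.Definitions using (DecidableEquality)
open import Relation.Binary.PropositionalEquality
  using (_≡_; _≢_; refl; sym; trans; cong; subst)
open import Relation.Nullary using (¬_)
open import Relation.Nullary.Decidable using (recompute; via-injection)

private
  variable
    a b c ℓ : Level

module Nominal (𝔸 : Set) (𝔸↔ℕ : 𝔸 ↔ ℕ) where

  _≟_ : DecidableEquality 𝔸
  _≟_ = via-injection (↔⇒↣ 𝔸↔ℕ) ℕ._≟_

  open DecMembership _≟_ using (_∈?_)

  record FinPerm : Set where
    field
      bijection : 𝔸 ↔ 𝔸
    open Inverse bijection public using (to; from; strictlyInverseˡ; strictlyInverseʳ)
    field
      finite : Σ[ M ∈ List 𝔸 ] (∀ a → a ∉ M → to a ≡ a)

  open FinPerm using (bijection; finite)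

  infixr 20 _⟨_⟩
  _⟨_⟩ : FinPerm → 𝔸 → 𝔸
  π ⟨ a ⟩ = FinPerm.to π a

  Perm : Group 0ℓ 0ℓ
  Perm = record
    { Carrier = FinPerm
    ; _≈_     = λ π ρ → ∀ a → π ⟨ a ⟩ ≡ ρ ⟨ a ⟩
    ; _∙_     = λ π ρ → record
        { bijection = bijection π ↔-∘ bijection ρ
        ; finite    = proj₁ (finite π) ++ proj₁ (finite ρ)
                    , λ a a∉ → trans
                        (cong (π ⟨_⟩) (proj₂ (finite ρ) a (a∉ ∘ ∈-++⁺ʳ _)))
                        (proj₂ (finite π) a (a∉ ∘ ∈-++⁺ˡ))
        }
    ; ε       = record { bijection = ↔-id 𝔸 ; finite = [] , λ _ _ → refl }
    ; _⁻¹     = λ π → record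
        { bijection = ↔-sym (bijection π)
        ; finite    = proj₁ (finite π)
                    , λ a a∉ → trans
                        (cong (FinPerm.from π) (sym (proj₂ (finite π) a a∉)))
                        (FinPerm.strictlyInverseʳ π a)
        }
    ; isGroup = record
        { isMonoid = record
            { isSemigroup = record
                { isMagma = record
                    { isEquivalence = record
                        { refl  = λ _ → refl
                        ; sym   = λ p a → sym (p a)
                        ; trans = λ p q a → trans (p a) (q a)
                        }
                    ; ∙-cong = λ {π} {π′} {ρ} {ρ′} p q a →
                        trans (cong (π ⟨_⟩) (q a)) (p (ρ′ ⟨ a ⟩))
                    }
                ; assoc = λ _ _ _ _ → refl
                }
            ; identity = (λ _ _ → refl) , (λ _ _ → refl)
            }
        ; inverse = FinPerm.strictlyInverseʳ , FinPerm.strictlyInverseˡ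
        ; ⁻¹-cong = λ {π} {ρ} p a → trans
            (cong (FinPerm.from π) (sym (trans (p _) (FinPerm.strictlyInverseˡ ρ a))))
            (FinPerm.strictlyInverseʳ π (FinPerm.from ρ a))
        }
    }

  module Perm = Group Perm

  record PermSet ℓ : Set (lsuc ℓ) where
    field
      setoid : Setoid ℓ ℓ
    open Setoid setoid public using (Carrier; _≈_; isEquivalence)
      renaming (refl to ≈-refl; sym to ≈-sym; trans to ≈-trans)
    infixr 20 _·_
    field
      _·_    : FinPerm → Carrier → Carrier
      ·-cong : ∀ {π ρ x y} → π Perm.≈ ρ → x ≈ y → π · x ≈ ρ · y
      ·-ε    : ∀ x → Perm.ε · x ≈ x
      ·-∙    : ∀ π ρ x → (π Perm.∙ ρ) · x ≈ π · ρ · x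

    ·-congʳ : ∀ π {x y} → x ≈ y → π · x ≈ π · y
    ·-congʳ π = ·-cong {π} {π} (λ _ → refl)

    Supports : List 𝔸 → Carrier → Set ℓ
    Supports S x = ∀ π → (∀ a → a ∈ S → π ⟨ a ⟩ ≡ a) → π · x ≈ x

    -- Membership in supp x. In a nominal set the least finite support is the
    -- intersection of all the finite supports. Listing its elements is not
    -- constructively possible in general, so it is a predicate on names.
    _∈supp_ : 𝔸 → Carrier → Set ℓ
    a ∈supp x = ∀ S → Supports S x → a ∈ S

    least-support : ∀ {S x} → Supports S x → (∀ T → Supports T x → S ⊆ T) →
                    ∀ a → a ∈ S ⇔ a ∈supp x
    least-support supp least a =
      mk⇔ (λ a∈S T supp′ → least T supp′ a∈S) (λ a∈ → a∈ _ supp)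

    infix 4 _#_
    _#_ : Rel Carrier ℓ
    x # y = ∀ a → ¬ (a ∈supp x × a ∈supp y)

  infix 1 _⇒_
  record _⇒_ (X : PermSet a) (Y : PermSet b) : Set (a ⊔ b) where
    private
      module X = PermSet X
      module Y = PermSet Y
    field
      func        : Func X.setoid Y.setoid
    open Func func public using () renaming (to to ⟦_⟧; cong to ⟦⟧-cong)
    field
      equivariant : ∀ π x → ⟦_⟧ (π X.· x) Y.≈ π Y.· ⟦_⟧ x

  open _⇒_ public using (⟦_⟧; ⟦⟧-cong; equivariant)

  Hom : PermSet a → PermSet b → Setoid (a ⊔ b) (a ⊔ b)
  Hom X Y = record
    { Carrier       = X ⇒ Y
    ; _≈_           = λ f g → ∀ x → ⟦ f ⟧ x Y.≈ ⟦ g ⟧ x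
    ; isEquivalence = record
        { refl  = λ _ → Y.≈-refl
        ; sym   = λ p x → Y.≈-sym (p x)
        ; trans = λ p q x → Y.≈-trans (p x) (q x)
        }
    }
    where module Y = PermSet Y

  infixr 9 _⊚_
  _⊚_ : {X : PermSet a} {Y : PermSet b} {Z : PermSet c} → Y ⇒ Z → X ⇒ Y → X ⇒ Z
  _⊚_ {Z = Z} g f = record
    { func = record
        { to   = λ x → ⟦ g ⟧ (⟦ f ⟧ x)
        ; cong = λ p → ⟦⟧-cong g (⟦⟧-cong f p)
        }
    ; equivariant = λ π x →
        Z.≈-trans (⟦⟧-cong g (equivariant f π x)) (equivariant g π (⟦ f ⟧ x))
    }
    where module Z = PermSet Z

  record NominalSet ℓ : Set (lsuc ℓ) where
    field
      permSet         : PermSet ℓ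
    open PermSet permSet public
    field
      finitelySupported : ∀ x → Σ[ S ∈ List 𝔸 ] Supports S x

  open NominalSet using (permSet)

  Nom : NominalSet a → NominalSet b → Setoid (a ⊔ b) (a ⊔ b)
  Nom X Y = Hom (permSet X) (permSet Y)

  Names : NominalSet 0ℓ
  Names = record
    { permSet = record
        { setoid = record
            { Carrier       = 𝔸
            ; _≈_           = _≡_
            ; isEquivalence = record { refl = refl ; sym = sym ; trans = trans }
            }
        ; _·_    = _⟨_⟩
        ; ·-cong = λ { {y = y} p refl → p y }
        ; ·-ε    = λ _ → refl
        ; ·-∙    = λ _ _ _ → refl
        }
    ; finitelySupported = λ x → x ∷ [] , λ π fix → fix x (here refl)
    }

  module _ (X : PermSet a) where
    open PermSet X

    ⁻¹-cancelˡ : ∀ π x → (π Perm.⁻¹) · π · x ≈ x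
    ⁻¹-cancelˡ π x = ≈-trans (≈-sym (·-∙ (π Perm.⁻¹) π x))
      (≈-trans (·-cong {ρ = Perm.ε} (Perm.inverseˡ π) ≈-refl) (·-ε x))

    ⁻¹-cancelʳ : ∀ π x → π · (π Perm.⁻¹) · x ≈ x
    ⁻¹-cancelʳ π x = ≈-trans (≈-sym (·-∙ π (π Perm.⁻¹) x))
      (≈-trans (·-cong {ρ = Perm.ε} (Perm.inverseʳ π) ≈-refl) (·-ε x))

    supports-· : ∀ π {S x} → Supports S x → Supports (map (π ⟨_⟩) S) (π · x)
    supports-· π {S} {x} supp ρ fix = ≈-trans (≈-sym (⁻¹-cancelʳ π (ρ · π · x)))
      (·-congʳ π (≈-trans
        (≈-sym (≈-trans (·-∙ (π Perm.⁻¹) (ρ Perm.∙ π) x)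
                        (·-congʳ (π Perm.⁻¹) (·-∙ ρ π x))))
        (supp ((π Perm.⁻¹) Perm.∙ (ρ Perm.∙ π)) λ a a∈S → trans
          (cong (FinPerm.from π) (fix (π ⟨ a ⟩) (∈-map⁺ (π ⟨_⟩) a∈S)))
          (Perm.inverseˡ π a))))

    ∈supp-· : ∀ π {c x} → c ∈supp (π · x) → ((π Perm.⁻¹) ⟨ c ⟩) ∈supp x
    ∈supp-· π {c} c∈ S supp with ∈-map⁻ (π ⟨_⟩) (c∈ _ (supports-· π supp))
    ... | d , d∈S , refl = subst (_∈ S) (sym (Perm.inverseˡ π d)) d∈S

    #-· : ∀ π {x y} → x # y → π · x # π · y
    #-· π x#y c (c∈x , c∈y) = x#y _ (∈supp-· π c∈x , ∈supp-· π c∈y)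

  module _ {X : PermSet a} {Y : PermSet b} (f : X ⇒ Y) where
    private
      module X = PermSet X
      module Y = PermSet Y

    supports-⟦⟧ : ∀ {S x} → X.Supports S x → Y.Supports S (⟦ f ⟧ x)
    supports-⟦⟧ {x = x} supp π fix =
      Y.≈-trans (Y.≈-sym (equivariant f π x)) (⟦⟧-cong f (supp π fix))

    #-⟦⟧ : ∀ {x y} → x X.# y → ⟦ f ⟧ x Y.# ⟦ f ⟧ y
    #-⟦⟧ x#y c (c∈x , c∈y) =
      x#y c ((λ S s → c∈x S (supports-⟦⟧ s)) , (λ S s → c∈y S (supports-⟦⟧ s)))

  -- Finite subsets of 𝔸, the objects of 𝕀. Lists with the same members name
  -- the same subset. A morphism of 𝕀 from A to B is an injection El A ↣ El B.

  -- The membership proof is irrelevant, so that elements are equal exactly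
  -- when they are equal as names.
  El : List 𝔸 → Set
  El A = Refinement 𝔸 (_∈ A)

  value-∈ : ∀ {A} (a : El A) → value a ∈ A
  value-∈ {A} (a Refinement., Irrelevant.[ a∈A ]) = recompute (a ∈? A) a∈A

  incl : ∀ A → El A ↣ 𝔸
  incl A = mk↣ {to = value} value-injective

  module _ (Y : NominalSet ℓ) where
    private module Y = NominalSet Y

    record Family (A : Set) : Set ℓ where
      field
        at       : A → Y.Carrier
        disjoint : ∀ {a b} → a ≢ b → at a Y.# at b

  open Family public using (at; disjoint)

  infixr 25 _^*_
  _^*_ : NominalSet ℓ → Set → PermSet ℓ
  Y ^* A = record
    { setoid = record
        { Carrier       = Family Y A
        ; _≈_           = λ γ δ → ∀ a → at γ a Y.≈ at δ a
        ; isEquivalence = record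
            { refl  = λ _ → Y.≈-refl
            ; sym   = λ p a → Y.≈-sym (p a)
            ; trans = λ p q a → Y.≈-trans (p a) (q a)
            }
        }
    ; _·_    = λ π γ → record
        { at       = λ a → π Y.· at γ a
        ; disjoint = λ a≢b → #-· Y.permSet π (disjoint γ a≢b)
        }
    ; ·-cong = λ {π} {ρ} p q a → Y.·-cong {π} {ρ} p (q a)
    ; ·-ε    = λ γ a → Y.·-ε (at γ a)
    ; ·-∙    = λ π ρ γ a → Y.·-∙ π ρ (at γ a)
    }
    where module Y = NominalSet Y

  infixl 25 _^*ᵢ_
  _^*ᵢ_ : (Y : NominalSet ℓ) {A B : Set} → A ↣ B → Y ^* B ⇒ Y ^* A
  Y ^*ᵢ i = record
    { func = record
        { to   = λ γ → record
            { at       = λ a → at γ (Injection.to i a)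
            ; disjoint = λ a≢b → disjoint γ (a≢b ∘ Injection.injective i)
            }
        ; cong = λ p a → p (Injection.to i a)
        }
    ; equivariant = λ _ _ _ → NominalSet.≈-refl Y
    }

  infixl 25 _*^_
  _*^_ : {Y : NominalSet a} {Y′ : NominalSet b} →
         permSet Y ⇒ permSet Y′ → (A : Set) → Y ^* A ⇒ Y′ ^* A
  v *^ A = record
    { func = record
        { to   = λ γ → record
            { at       = λ a → ⟦ v ⟧ (at γ a)
            ; disjoint = λ a≢b → #-⟦⟧ v (disjoint γ a≢b)
            }
        ; cong = λ p a → ⟦⟧-cong v (p a)
        }
    ; equivariant = λ π γ a → equivariant v π (at γ a)
    }

  ^*-finitelySupported : (Y : NominalSet ℓ) (A : List 𝔸) (γ : Family Y (El A)) →
                         Σ[ S ∈ List 𝔸 ] PermSet.Supports (Y ^* El A) S γ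
  ^*-finitelySupported Y A γ =
    concat (mapWith∈ A suppAt) , λ π fix a →
      proj₂ (Y.finitelySupported (at γ a)) π λ c c∈ →
        fix c (∈-concat⁺ (mapWith∈⁺ suppAt
          ( value a
          , value-∈ a
          , c∈)))
    where
    module Y = NominalSet Y
    suppAt : ∀ {x} → x ∈ A → List 𝔸
    suppAt {x} x∈A = proj₁ (Y.finitelySupported (at γ (x Refinement., Irrelevant.pure x∈A)))

  _^*ᶠ_ : NominalSet ℓ → List 𝔸 → NominalSet ℓ
  Y ^*ᶠ A = record
    { permSet           = Y ^* El A
    ; finitelySupported = ^*-finitelySupported Y A
    }

  -- The substitution tensor X ◇ Y = ∫^{A∈𝕀} Nom(𝔸^{*A}, X) · Y^{*A}

  module Tensor (X : NominalSet a) (Y : NominalSet a) where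
    private
      module X = NominalSet X
      module Y = NominalSet Y

    ∐ : Set a
    ∐ = Σ[ A ∈ List 𝔸 ] Setoid.Carrier (Nom (Names ^*ᶠ A) X) × Family Y (El A)

    -- The coend identifies the two images of each element of
    -- Nom(𝔸^{*A}, X) · Y^{*B}, for each morphism i : A → B of 𝕀.
    data _⟶_ : Rel ∐ a where
      resp  : ∀ {A} {f f′ : Names ^* El A ⇒ X.permSet} {γ γ′ : Family Y (El A)} →
              Setoid._≈_ (Nom (Names ^*ᶠ A) X) f f′ →
              PermSet._≈_ (Y ^* El A) γ γ′ →
              (A , f , γ) ⟶ (A , f′ , γ′)
      glide : ∀ {A B} (i : El A ↣ El B)
              (f : Names ^* El A ⇒ X.permSet) (γ : Family Y (El B)) →
              (A , f , ⟦ Y ^*ᵢ i ⟧ γ) ⟶ (B , f ⊚ (Names ^*ᵢ i) , γ)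

    setoid : Setoid a a
    setoid = EqC.setoid _⟶_

    infixr 20 _·_
    _·_ : FinPerm → ∐ → ∐
    π · (A , f , γ) = A , f , PermSet._·_ (Y ^* El A) π γ

    ·-resp : ∀ π {s t} → s ⟶ t → (π · s) ⟶ (π · t)
    ·-resp π (resp p q)    = resp p (λ a → Y.·-congʳ π (q a))
    ·-resp π (glide i f γ) = glide i f (PermSet._·_ (Y ^* El _) π γ)

    byResp : ∀ {A} {f : Names ^* El A ⇒ X.permSet} {γ γ′ : Family Y (El A)} →
             PermSet._≈_ (Y ^* El A) γ γ′ →
             Setoid._≈_ setoid (A , f , γ) (A , f , γ′)
    byResp q = fwd (resp (λ _ → X.≈-refl) q) ◅ ε

  infixr 15 _◇_
  _◇_ : NominalSet a → NominalSet a → NominalSet a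
  X ◇ Y = record
    { permSet = record
        { setoid = setoid
        ; _·_    = _·_
        ; ·-cong = λ { {π} {ρ} {A , f , γ} p q →
            EqC.transitive _⟶_
              (byResp (λ _ → Y.·-cong {π} {ρ} p Y.≈-refl))
              (EqC.gmap (ρ ·_) (·-resp ρ) q) }
        ; ·-ε    = λ { (A , f , γ) → byResp (PermSet.·-ε (Y ^* El A) γ) }
        ; ·-∙    = λ { π ρ (A , f , γ) → byResp (PermSet.·-∙ (Y ^* El A) π ρ γ) }
        }
    ; finitelySupported = λ { (A , f , γ) →
        let S , supp = ^*-finitelySupported Y A γ
        in S , λ π fix → byResp (supp π fix) }
    }
    where
    open Tensor X Y
    module Y = NominalSet Y

  infixr 15 _◇₁_
  _◇₁_ : {X X′ Y Y′ : NominalSet a} →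
         permSet X ⇒ permSet X′ → permSet Y ⇒ permSet Y′ →
         permSet (X ◇ Y) ⇒ permSet (X′ ◇ Y′)
  _◇₁_ {X = X} {X′} {Y} {Y′} u v = record
    { func = record
        { to   = on
        ; cong = EqC.gfold (Setoid.isEquivalence (Tensor.setoid X′ Y′)) on on-resp
        }
    ; equivariant = λ { π (A , f , γ) →
        Tensor.byResp X′ Y′ {f = u ⊚ f} (equivariant (_*^_ {Y = Y} {Y′} v (El A)) π γ) }
    }
    where
    module X′ = NominalSet X′
    module Y′ = NominalSet Y′

    on : Tensor.∐ X Y → Tensor.∐ X′ Y′
    on (A , f , γ) = A , u ⊚ f , ⟦ v *^ El A ⟧ γ

    on-resp : ∀ {s t} → Tensor._⟶_ X Y s t →
              Setoid._≈_ (Tensor.setoid X′ Y′) (on s) (on t)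
    on-resp (Tensor.resp p q)    =
      fwd (Tensor.resp (λ x → ⟦⟧-cong u (p x)) (λ a → ⟦⟧-cong v (q a))) ◅ ε
    on-resp (Tensor.glide i f γ) =
      Tensor.byResp X′ Y′ (λ _ → Y′.≈-refl) ◅◅
      fwd (Tensor.glide i (u ⊚ f) (⟦ v *^ _ ⟧ γ)) ◅
      fwd (Tensor.resp (λ _ → X′.≈-refl) (λ _ → Y′.≈-refl)) ◅ ε

  module _ (Y : NominalSet a) (Z : NominalSet b) where
    private module Z = NominalSet Z

    -- The factor g is a map of underlying sets; it need not be equivariant.
    ReducibleTo : List 𝔸 → (Y ^* 𝔸 ⇒ Z.permSet) → Set (a ⊔ b)
    ReducibleTo A f =
      Σ[ g ∈ Func (PermSet.setoid (Y ^* El A)) Z.setoid ]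
        (∀ γ → ⟦ f ⟧ γ Z.≈ Func.to g (⟦ Y ^*ᵢ incl A ⟧ γ))

    FinitelyReducible : (Y ^* 𝔸 ⇒ Z.permSet) → Set (a ⊔ b)
    FinitelyReducible f = Σ[ A ∈ List 𝔸 ] ReducibleTo A f

  infixl 25 _∘ₚ_
  _∘ₚ_ : {Y : NominalSet a} → Family Y 𝔸 → FinPerm → Family Y 𝔸
  _∘ₚ_ {Y = Y} γ π = ⟦ Y ^*ᵢ ↔⇒↣ (bijection π) ⟧ γ

  [_,_]◇ : NominalSet a → NominalSet a → NominalSet a
  [ Y , Z ]◇ = record
    { permSet = record
        { setoid = record
            { Carrier       = ∃ (FinitelyReducible Y Z)
            ; _≈_           = λ F G → Setoid._≈_ H (proj₁ F) (proj₁ G)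
            ; isEquivalence = record
                { refl  = λ _ → Z.≈-refl
                ; sym   = λ p γ → Z.≈-sym (p γ)
                ; trans = λ p q γ → Z.≈-trans (p γ) (q γ)
                }
            }
        ; _·_    = act
        ; ·-cong = λ { {π} {ρ} {f , _} {f′ , _} p q γ → Z.≈-trans
            (⟦⟧-cong f (at-cong γ {π} {ρ} p)) (q (_∘ₚ_ {Y = Y} γ ρ)) }
        ; ·-ε    = λ _ _ → Z.≈-refl
        ; ·-∙    = λ _ _ _ _ → Z.≈-refl
        }
    ; finitelySupported = λ { (f , A , g , f≈g) → A , λ π fix γ →
        Z.≈-trans (f≈g (_∘ₚ_ {Y = Y} γ π)) (Z.≈-trans
          (Func.cong g λ a → Y.reflexive (cong (at γ) (fix (value a) (value-∈ a))))
          (Z.≈-sym (f≈g γ))) }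
    }
    where
    module Y where
      open NominalSet Y public
      open Setoid setoid public using (reflexive)
    module Z = NominalSet Z
    H = Hom (Y ^* 𝔸) Z.permSet

    at-cong : ∀ (γ : Family Y 𝔸) {π ρ} → π Perm.≈ ρ → ∀ a →
              at (_∘ₚ_ {Y = Y} γ π) a Y.≈ at (_∘ₚ_ {Y = Y} γ ρ) a
    at-cong γ p a = Y.reflexive (cong (at γ) (p a))

    -- (π · f)(γ) = f(γπ), which is reducible to πA if f is reducible to A.
    act : FinPerm → ∃ (FinitelyReducible Y Z) → ∃ (FinitelyReducible Y Z)
    act π (f , A , g , f≈g) =
        f ⊚ (Y ^*ᵢ ↔⇒↣ (bijection π))
      , map (π ⟨_⟩) A
      , record
          { to   = λ δ → Func.to g (⟦ Y ^*ᵢ π∣A ⟧ δ)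
          ; cong = λ p → Func.cong g (λ a → p (Injection.to π∣A a))
          }
      , λ γ → f≈g (_∘ₚ_ {Y = Y} γ π)
      where
      π∣A : El A ↣ El (map (π ⟨_⟩) A)
      π∣A = mk↣ {to = Refinement.map (π ⟨_⟩) (∈-map⁺ (π ⟨_⟩))}
        λ p → value-injective (Injection.injective (↔⇒↣ (bijection π)) (cong value p))

  [_,_]₁ : {Y Y′ Z Z′ : NominalSet a} →
           permSet Y′ ⇒ permSet Y → permSet Z ⇒ permSet Z′ →
           permSet [ Y , Z ]◇ ⇒ permSet [ Y′ , Z′ ]◇
  [_,_]₁ {Y = Y} {Y′} {Z} {Z′} v w = record
    { func = record
        { to   = λ { (f , A , g , f≈g) →
              w ⊚ f ⊚ (v *^ 𝔸)
            , A
            , record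
                { to   = λ δ → ⟦ w ⟧ (Func.to g (⟦ v *^ El A ⟧ δ))
                ; cong = λ p → ⟦⟧-cong w (Func.cong g (λ a → ⟦⟧-cong v (p a)))
                }
            , λ γ → ⟦⟧-cong w (f≈g (⟦ v *^ 𝔸 ⟧ γ)) }
        ; cong = λ p γ → ⟦⟧-cong w (p (⟦ v *^ 𝔸 ⟧ γ))
        }
    ; equivariant = λ _ _ _ → NominalSet.≈-refl Z′
    }

  -- For empty Y the adjunction fails: Y^{*𝔸} is empty, so [Y,Z]◇ has exactly one
  -- element, while 1 ◇ Y ≅ 1. With Z discrete on two points, Nom(1 ◇ Y, Z) has
  -- two elements and Nom(1, [Y,Z]◇) has one.
  Inhabited : NominalSet ℓ → Set ℓ
  Inhabited Y = NominalSet.Carrier Y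

{-# OPTIONS --safe #-}

-- Equivariant maps f : 𝔸^{*A} → X correspond to elements x = f(ι) of X supported by A, where ι is
-- the inclusion of A, because every injection of A into 𝔸 extends to a finite permutation. So the
-- transpose of h : X ◇ Y → Z sends x and γ ∈ Y^{*𝔸} to h(x[γ restricted to a support of x]).
-- Conversely, F : X → [Y,Z]◇ gives the map x[γ] ↦ F(x)(γ̂), where γ̂ extends γ to all names by
-- disjoint translates of some y₀ ∈ Y. This is well defined because F(x) only depends on the
-- restriction of its argument to any support of x.

module Submission where

open import Data.Nat.Base using (ℕ; suc; _+_; _*_; _/_; _<_; s≤s; NonZero)
open import Data.Product.Base using (Σ-syntax; _×_; _,_; proj₁; proj₂)
open import Function.Bundles using (Func; Injection; Inverse; _↔_; _↣_; mk↣; mk↔ₛ′)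
open import Function.Definitions using (Bijective)
open import Level using (Level)
open import Relation.Binary.Bundles using (Setoid)
open import Defs
import Data.Irrelevant as Irrelevant
open import Data.List.Base using (List; []; _∷_; _++_; map)
import Data.List.Extrema as Extrema
open import Data.List.Membership.Propositional using (_∈_; _∉_; mapWith∈)
open import Data.List.Membership.Propositional.Properties using (∈-++⁺ˡ; ∈-++⁺ʳ; ∈-map⁺; ∈-map⁻)
import Data.List.Membership.DecPropositional as DecMembership
open import Data.List.Relation.Unary.All using (lookup)
open import Data.List.Relation.Unary.Any using (here; there)
open import Data.List.Relation.Unary.Any.Properties using (mapWith∈⁺)
open import Data.Nat.Divisibility using (n∣m*n)
open import Data.Nat.DivMod using (m<n⇒m/n≡0; m*n/n≡m; +-distrib-/-∣ʳ)
import Data.Nat.Properties as ℕ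
open import Data.Refinement as Refinement using (value; value-injective)
open import Function.Base using (_∘_)
open import Function.Construct.Identity using (↣-id)
open import Function.Properties.Inverse using (↔⇒↣)
import Relation.Binary.Construct.Closure.Equivalence as EqC
open import Relation.Binary.Construct.Closure.ReflexiveTransitive using (ε; _◅_)
open import Relation.Binary.Construct.Closure.Symmetric using (fwd; bwd)
open import Relation.Binary.Definitions using (DecidableEquality)
open import Relation.Binary.PropositionalEquality
  using (_≡_; _≢_; refl; sym; trans; cong; subst)
import Relation.Binary.Reasoning.Setoid as SetoidReasoning
open import Relation.Nullary using (Dec; yes; no; contradiction)
open import Relation.Nullary.Decidable using (via-injection; decidable-stable)

private
  variable
    a : Level

module Adjunction (𝔸 : Set) (𝔸↔ℕ : 𝔸 ↔ ℕ) where

  open Nominal 𝔸 𝔸↔ℕ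
  open NominalSet using (permSet)
  open DecMembership _≟_ using (_∈?_)

  private
    variable
      A B : List 𝔸

  -- Numbering of the names, and fresh names.

  index : 𝔸 → ℕ
  index = Inverse.to 𝔸↔ℕ

  name : ℕ → 𝔸
  name = Inverse.from 𝔸↔ℕ

  index-name : ∀ n → index (name n) ≡ n
  index-name = Inverse.strictlyInverseˡ 𝔸↔ℕ

  index-injective : ∀ {c d} → index c ≡ index d → c ≡ d
  index-injective = Injection.injective (↔⇒↣ 𝔸↔ℕ)

  -- The successor makes the bound strict, so `name (bound S)` is fresh for `S`, and nonzero, so it
  -- can serve as a block length below.
  bound : List 𝔸 → ℕ
  bound S = suc (max 0 (map index S))
    where open Extrema ℕ.≤-totalOrder using (max)

  index<bound : ∀ {c S} → c ∈ S → index c < bound S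
  index<bound {S = S} c∈S = s≤s (lookup (xs≤max 0 (map index S)) (∈-map⁺ index c∈S))
    where open Extrema ℕ.≤-totalOrder using (xs≤max)

  bound-fresh : ∀ S → name (bound S) ∉ S
  bound-fresh S c∈S = ℕ.<-irrefl (index-name (bound S)) (index<bound c∈S)

  -- Transpositions, and the extension of finite injections to finite permutations.

  transpose : 𝔸 → 𝔸 → 𝔸 → 𝔸
  transpose c d e with e ≟ c | e ≟ d
  ... | yes _ | _     = d
  ... | no _  | yes _ = c
  ... | no _  | no _  = e

  transpose-left : ∀ c d → transpose c d c ≡ d
  transpose-left c d with c ≟ c
  ... | yes _   = refl
  ... | no  c≢c = contradiction refl c≢c

  transpose-right : ∀ c d → transpose c d d ≡ c
  transpose-right c d with d ≟ c | d ≟ d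
  ... | yes d≡c | _       = d≡c
  ... | no _    | yes _   = refl
  ... | no _    | no  d≢d = contradiction refl d≢d

  transpose-other : ∀ {c d e} → e ≢ c → e ≢ d → transpose c d e ≡ e
  transpose-other {c} {d} {e} e≢c e≢d with e ≟ c | e ≟ d
  ... | yes e≡c | _       = contradiction e≡c e≢c
  ... | no _    | yes e≡d = contradiction e≡d e≢d
  ... | no _    | no _    = refl

  transpose-involutive : ∀ c d e → transpose c d (transpose c d e) ≡ e
  transpose-involutive c d e with e ≟ c | e ≟ d
  ... | yes refl | _        = transpose-right c d
  ... | no _     | yes refl = transpose-left c d
  ... | no e≢c   | no e≢d   = transpose-other e≢c e≢d

  swap : 𝔸 → 𝔸 → FinPerm
  swap c d = record
    { bijection = mk↔ₛ′ (transpose c d) (transpose c d)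
                    (transpose-involutive c d) (transpose-involutive c d)
    ; finite    = c ∷ d ∷ [] , λ _ e∉ →
        transpose-other (e∉ ∘ here) (e∉ ∘ there ∘ here)
    }

  ⟨⟩-injective : ∀ π {c d} → π ⟨ c ⟩ ≡ π ⟨ d ⟩ → c ≡ d
  ⟨⟩-injective π = Injection.injective (↔⇒↣ (FinPerm.bijection π))

  -- Induction on `L`: a transposition corrects the value at the new index `k`. It leaves the
  -- earlier values alone, since these differ from `π ⟨ i k ⟩` by injectivity of `π` and `i`, and
  -- from `j k` by injectivity of `j`.
  extend-injection : ∀ {I : Set} (i j : I ↣ 𝔸) (L : List I) →
                Σ[ π ∈ FinPerm ] (∀ {k} → k ∈ L → π ⟨ Injection.to i k ⟩ ≡ Injection.to j k)
  extend-injection i j []      = Perm.ε , λ ()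
  extend-injection i j (k ∷ L) = swap (π ⟨ i.to k ⟩) (j.to k) Perm.∙ π , λ where
      (here refl)  → transpose-left (π ⟨ i.to k ⟩) (j.to k)
      (there k′∈L) → later k′∈L
    where
    module i = Injection i
    module j = Injection j
    π = proj₁ (extend-injection i j L)
    later : ∀ {k′} → k′ ∈ L → transpose (π ⟨ i.to k ⟩) (j.to k) (π ⟨ i.to k′ ⟩) ≡ j.to k′
    later {k′} k′∈L with i.to k′ ≟ i.to k
    ... | yes eq rewrite i.injective eq = transpose-left (π ⟨ i.to k ⟩) (j.to k)
    ... | no  i≢ = trans
        (transpose-other (i≢ ∘ ⟨⟩-injective π)
          (λ eq → i≢ (cong i.to (j.injective (trans (sym πi≡j) eq)))))
        πi≡j
      where πi≡j = proj₂ (extend-injection i j L) k′∈L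

  -- Supports, and families of names as injections.

  module _ (X : PermSet a) where
    open PermSet X

    -- The composite of `π` with the inverse of `ρ` fixes `S` pointwise.
    agree-on-support : ∀ {S x} → Supports S x → ∀ π ρ →
                       (∀ c → c ∈ S → π ⟨ c ⟩ ≡ ρ ⟨ c ⟩) → π · x ≈ ρ · x
    agree-on-support {x = x} supp π ρ p = begin
      π · x                          ≈⟨ ⁻¹-cancelʳ X ρ (π · x) ⟨
      ρ · (ρ Perm.⁻¹) · π · x        ≈⟨ ·-congʳ ρ (·-∙ (ρ Perm.⁻¹) π x) ⟨
      ρ · ((ρ Perm.⁻¹) Perm.∙ π) · x ≈⟨ ·-congʳ ρ (supp ((ρ Perm.⁻¹) Perm.∙ π) λ c c∈S →
          trans (cong (FinPerm.from ρ) (p c c∈S)) (Perm.inverseˡ ρ c)) ⟩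
      ρ · x                          ∎
      where open SetoidReasoning setoid

  open NominalSet Names using () renaming (_∈supp_ to _∈suppName_)

  ∈supp-name⁻ : ∀ {c d} → c ∈suppName d → c ≡ d
  ∈supp-name⁻ {d = d} c∈ with c∈ (d ∷ []) (proj₂ (NominalSet.finitelySupported Names d))
  ... | here c≡d = c≡d

  -- If `c ∉ S`, swapping `c` with a fresh name fixes `S` pointwise but moves `c`, so `S` does not
  -- support `c`.
  ∈supp-name : ∀ c → c ∈suppName c
  ∈supp-name c S supp = decidable-stable (c ∈? S) λ c∉S →
    bound-fresh (c ∷ S) (here (trans (sym (transpose-left c d)) (supp (swap c d) λ e e∈S →
      transpose-other (λ { refl → c∉S e∈S }) (λ { refl → bound-fresh (c ∷ S) (there e∈S) }))))
    where d = name (bound (c ∷ S))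

  injection⇒family : ∀ {I : Set} → I ↣ 𝔸 → Family Names I
  injection⇒family i = record
    { at       = Injection.to i
    ; disjoint = λ k≢l c (c∈k , c∈l) → k≢l (Injection.injective i
        (trans (sym (∈supp-name⁻ c∈k)) (∈supp-name⁻ c∈l)))
    }

  -- Disjointness only refutes `k ≢ l`; decidable equality on `I` turns this into `k ≡ l`.
  family⇒injection : ∀ {I : Set} → DecidableEquality I → Family Names I → I ↣ 𝔸
  family⇒injection _≟I_ j = mk↣ {to = at j} λ {k} {l} eq → decidable-stable (k ≟I l) λ k≢l →
    disjoint j k≢l (at j k) (∈supp-name _ , subst (at j k ∈suppName_) eq (∈supp-name _))

  _≟El_ : DecidableEquality (El A)
  _≟El_ {A} = via-injection (incl A) _≟_

  elements : ∀ A → List (El A)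
  elements A = mapWith∈ A λ {c} c∈A → c Refinement., Irrelevant.pure c∈A

  ∈-elements : (k : El A) → k ∈ elements A
  ∈-elements k = mapWith∈⁺ _ (value k , value-∈ k , refl)

  ι : ∀ A → Family Names (El A)
  ι A = injection⇒family (incl A)

  abstract
    realise : Family Names (El A) → FinPerm
    realise {A} j = proj₁ (extend-injection (incl A) (family⇒injection _≟El_ j) (elements A))

    realise-at : (j : Family Names (El A)) → ∀ k → realise j ⟨ value k ⟩ ≡ at j k
    realise-at {A} j k =
      proj₂ (extend-injection (incl A) (family⇒injection _≟El_ j) (elements A)) (∈-elements k)

  ι-supported : ∀ A → PermSet.Supports (Names ^* El A) A (ι A)
  ι-supported A π fix k = fix (value k) (value-∈ k)

  -- Equivariant maps out of `Names ^* El A` as elements supported by `A`.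

  module _ (X : PermSet a) where
    private module X = PermSet X

    at-ι : (f : Names ^* El A ⇒ X) (π : FinPerm) {j : Family Names (El A)} →
           (∀ k → π ⟨ value k ⟩ ≡ at j k) → ⟦ f ⟧ j X.≈ π X.· ⟦ f ⟧ (ι A)
    at-ι {A} f π p = X.≈-trans (⟦⟧-cong f (λ k → sym (p k))) (equivariant f π (ι A))

    -- `Names ^* El A` is a single orbit: `realise j` carries `ι A` to `j`.
    determined : (f g : Names ^* El A ⇒ X) → ⟦ f ⟧ (ι A) X.≈ ⟦ g ⟧ (ι A) →
                 ∀ j → ⟦ f ⟧ j X.≈ ⟦ g ⟧ j
    determined f g eq j = X.≈-trans (at-ι f (realise j) (realise-at j))
      (X.≈-trans (X.·-congʳ (realise j) eq) (X.≈-sym (at-ι g (realise j) (realise-at j))))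

    -- The map that sends `ι A` to `x`. As `A` supports `x`, only the values of `realise j` on `A`
    -- matter, and these are given by `j`.
    orbit : ∀ {x} → X.Supports A x → Names ^* El A ⇒ X
    orbit {A} {x} supp = record
      { func = record
          { to   = λ j → realise j X.· x
          ; cong = λ {j} {j′} p → agree-on-support X supp (realise j) (realise j′) λ c c∈A →
              let k = c Refinement., Irrelevant.pure c∈A
              in trans (realise-at j k) (trans (p k) (sym (realise-at j′ k)))
          }
      ; equivariant = λ π j → X.≈-trans
          (agree-on-support X supp (realise (π · j)) (π Perm.∙ realise j) λ c c∈A →
            let k = c Refinement., Irrelevant.pure c∈A
            in trans (realise-at (π · j) k) (cong (π ⟨_⟩) (sym (realise-at j k))))
          (X.·-∙ π (realise j) x)
      }
      where open PermSet (Names ^* El A) using (_·_)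

    orbit-ι : ∀ {x} (supp : X.Supports A x) → ⟦ orbit supp ⟧ (ι A) X.≈ x
    orbit-ι {A} {x} supp = X.≈-trans
      (agree-on-support X supp (realise (ι A)) Perm.ε λ c c∈A →
        realise-at (ι A) (c Refinement., Irrelevant.pure c∈A))
      (X.·-ε x)

  -- The transpose of a map out of the tensor, and its naturality.

  weakenˡ : El A ↣ El (A ++ B)
  weakenˡ = mk↣ {to = Refinement.map (λ c → c) ∈-++⁺ˡ} (value-injective ∘ cong value)

  weakenʳ : El B ↣ El (A ++ B)
  weakenʳ {A = A} = mk↣ {to = Refinement.map (λ c → c) (∈-++⁺ʳ A)} (value-injective ∘ cong value)

  module _ (X Y : NominalSet a) where
    private
      module X = NominalSet X
      module X◇Y = NominalSet (X ◇ Y)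
    open Tensor X Y using (resp; glide)

    restrict : (γ : Family Y 𝔸) → ∀ A → Family Y (El A)
    restrict γ A = ⟦ Y ^*ᵢ incl A ⟧ γ

    -- Both sides glide to `A ++ B` with the same family there, and the two maps on
    -- `Names ^* El (A ++ B)` agree at `ι (A ++ B)`.
    ◇-determined : (f : Names ^* El A ⇒ X.permSet) (g : Names ^* El B ⇒ X.permSet)
                   (γ : Family Y 𝔸) → ⟦ f ⟧ (ι A) X.≈ ⟦ g ⟧ (ι B) →
                   (A , f , restrict γ A) X◇Y.≈ (B , g , restrict γ B)
    ◇-determined {A} {B} f g γ eq =
      fwd (glide weakenˡ f (restrict γ (A ++ B))) ◅
      fwd (resp (determined X.permSet (f ⊚ Names ^*ᵢ weakenˡ) (g ⊚ Names ^*ᵢ weakenʳ {A = A}) eq′)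
            (λ _ → NominalSet.≈-refl Y)) ◅
      bwd (glide (weakenʳ {A = A}) g (restrict γ (A ++ B))) ◅ ε
      where
      eq′ : ⟦ f ⊚ Names ^*ᵢ weakenˡ ⟧ (ι (A ++ B)) X.≈
            ⟦ g ⊚ Names ^*ᵢ weakenʳ {A = A} ⟧ (ι (A ++ B))
      eq′ = X.≈-trans (⟦⟧-cong f (λ _ → refl)) (X.≈-trans eq (⟦⟧-cong g (λ _ → refl)))

  restrict-perm : ∀ π A → El A ↣ El (map (π ⟨_⟩) A)
  restrict-perm π A = mk↣ {to = Refinement.map (π ⟨_⟩) (∈-map⁺ (π ⟨_⟩))}
    (value-injective ∘ ⟨⟩-injective π ∘ cong value)

  module _ (X Y Z : NominalSet a) where
    private
      module X = NominalSet X
      module Z = NominalSet Z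
      module [Y,Z] = NominalSet [ Y , Z ]◇
    open Tensor X Y using (glide)

    eval : permSet (X ◇ Y) ⇒ permSet Z → X.Carrier → Family Y 𝔸 → Z.Carrier
    eval h x γ =
      let S , supp = X.finitelySupported x
      in ⟦ h ⟧ (S , orbit X.permSet supp , restrict X Y γ S)

    -- Frees `eval` from the chosen support: any presentation of `x` as a value at some `ι A` may be
    -- used instead.
    eval-at : ∀ h (f : Names ^* El A ⇒ X.permSet) {x} γ → x X.≈ ⟦ f ⟧ (ι A) →
              eval h x γ Z.≈ ⟦ h ⟧ (A , f , restrict X Y γ A)
    eval-at h f {x} γ eq =
      let _ , supp = X.finitelySupported x
      in ⟦⟧-cong h (◇-determined X Y (orbit X.permSet supp) f γ
           (X.≈-trans (orbit-ι X.permSet supp) eq))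

    -- With `x` presented by `f` over `S`, precomposing `f` with restriction along `π : S → πS`
    -- presents `π · x` over `πS`. Gliding back along this injection turns `γ` into `γπ`.
    eval-· : ∀ h π x γ → eval h (π X.· x) γ Z.≈ eval h x (_∘ₚ_ {Y = Y} γ π)
    eval-· h π x γ =
      let S , supp = X.finitelySupported x
          f = orbit X.permSet supp
          i = restrict-perm π S
      in Z.≈-trans
        (eval-at h (f ⊚ Names ^*ᵢ i) γ (X.≈-sym (X.≈-trans
          (at-ι X.permSet f π {⟦ Names ^*ᵢ i ⟧ (ι (map (π ⟨_⟩) S))} λ _ → refl)
          (X.·-congʳ π (orbit-ι X.permSet supp)))))
        (⟦⟧-cong h (bwd (glide i f (restrict X Y γ (map (π ⟨_⟩) S))) ◅ ε))

    curry : permSet (X ◇ Y) ⇒ permSet Z → permSet X ⇒ permSet [ Y , Z ]◇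
    curry h = record
      { func = record
          { to   = curryOn
          ; cong = λ {x} {x′} x≈x′ γ →
              let _ , supp = X.finitelySupported x′
              in eval-at h (orbit X.permSet supp) γ
                   (X.≈-trans x≈x′ (X.≈-sym (orbit-ι X.permSet supp)))
          }
      ; equivariant = eval-· h
      }
      where
      curryOn : X.Carrier → [Y,Z].Carrier
      curryOn x =
        let S , supp = X.finitelySupported x
            f = orbit X.permSet supp
        in record
             { func = record
                 { to   = eval h x
                 ; cong = λ p → ⟦⟧-cong h (Tensor.byResp X Y {f = f} (λ k → p (value k)))
                 }
             ; equivariant = λ π γ → equivariant h π (S , f , restrict X Y γ S)
             }
         , S
         , record
             { to   = λ δ → ⟦ h ⟧ (S , f , δ)
             ; cong = λ p → ⟦⟧-cong h (Tensor.byResp X Y {f = f} p)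
             }
         , λ _ → Z.≈-refl

    curryFunc : Func (Nom (X ◇ Y) Z) (Nom X [ Y , Z ]◇)
    curryFunc = record
      { to   = curry
      ; cong = λ p x γ → p _
      }

  curry-natural :
    (X X′ Y Y′ Z Z′ : NominalSet a)
    (u : permSet X′ ⇒ permSet X) (v : permSet Y′ ⇒ permSet Y) (w : permSet Z ⇒ permSet Z′)
    (h : permSet (X ◇ Y) ⇒ permSet Z) →
    Setoid._≈_ (Nom X′ [ Y′ , Z′ ]◇)
      (curry X′ Y′ Z′ (w ⊚ h ⊚ (_◇₁_ {X = X′} {X} {Y′} {Y} u v)))
      ([_,_]₁ {Y = Y} {Y′} {Z} {Z′} v w ⊚ curry X Y Z h ⊚ u)
  curry-natural X X′ Y Y′ Z Z′ u v w h x γ =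
    let S , supp = NominalSet.finitelySupported X′ x
        f = orbit (permSet X′) supp
    -- The chosen supports of `x` and `⟦ u ⟧ x` may differ, but `u ⊚ f` presents `⟦ u ⟧ x` over the
    -- support of `x`.
    in ⟦⟧-cong w (Z.≈-sym (Z.≈-trans
         (eval-at X Y Z h (u ⊚ f) (⟦ v *^ 𝔸 ⟧ γ)
           (⟦⟧-cong u (NominalSet.≈-sym X′ (orbit-ι (permSet X′) supp))))
         (⟦⟧-cong h (Tensor.byResp X Y (λ _ → NominalSet.≈-refl Y)))))
    where module Z = NominalSet Z

  -- Extending finite families to all names, by means of blocks of `n` consecutive names.

  block : (n : ℕ) → .{{NonZero n}} → 𝔸 → ℕ
  block n c = index c / n

  block-zero : ∀ S {c} → c ∈ S → block (bound S) c ≡ 0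
  block-zero S c∈S = m<n⇒m/n≡0 (index<bound c∈S)

  shift : (n : ℕ) → .{{NonZero n}} → ℕ → 𝔸 ↣ 𝔸
  shift n m = mk↣ {to = λ c → name (index c + m * n)} λ {c} {d} eq → index-injective
    (ℕ.+-cancelʳ-≡ (m * n) (index c) (index d)
      (trans (sym (index-name _)) (trans (cong index eq) (index-name _))))

  block-shift : ∀ n .{{_ : NonZero n}} m {c} → block n c ≡ 0 →
                block n (Injection.to (shift n m) c) ≡ m
  block-shift n m {c} eq = trans (cong (_/ n) (index-name _))
    (trans (+-distrib-/-∣ʳ (index c) (n∣m*n m))
      (trans (cong (_+ m * n / n) eq) (m*n/n≡m m n)))

  module _ (Y : NominalSet a) where
    private module Y = NominalSet Y

    -- The elements of the given family on A live in block 0, and a translate of y₀ in block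
    -- 1 + index c is used at each name c outside A.
    module Extend (y₀ : Y.Carrier) (n : ℕ) .{{_ : NonZero n}}
                  (y₀-block : ∀ {c} → c ∈ proj₁ (Y.finitelySupported y₀) → block n c ≡ 0) where

      private
        S₀ = proj₁ (Y.finitelySupported y₀)

      -- A shift by `m` blocks is in general not onto, but to move `y₀` a finite permutation that
      -- agrees with it on `S₀` suffices.
      translation : ∀ m → Σ[ π ∈ FinPerm ] (∀ {c} → c ∈ S₀ → π ⟨ c ⟩ ≡ Injection.to (shift n m) c)
      translation m = extend-injection (↣-id 𝔸) (shift n m) S₀

      copy : ℕ → Y.Carrier
      copy m = proj₁ (translation m) Y.· y₀

      copy-block : ∀ m {c} → c Y.∈supp copy m → block n c ≡ m
      copy-block m c∈ with ∈-map⁻ _ (c∈ _ (supports-· Y.permSet (proj₁ (translation m))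
                                           (proj₂ (Y.finitelySupported y₀))))
      ... | d , d∈S₀ , refl = trans (cong (block n) (proj₂ (translation m) d∈S₀))
                                    (block-shift n m (y₀-block d∈S₀))

      module _ (γ : Family Y (El A)) where

        -- The decision is an argument so that the lemmas about `pick` can split on it directly.
        pick : ∀ c → Dec (c ∈ A) → Y.Carrier
        pick c (yes c∈A) = at γ (c Refinement., Irrelevant.pure c∈A)
        pick c (no  _)   = copy (suc (index c))

        pick-∈ : ∀ k p → pick (value k) p Y.≈ at γ k
        pick-∈ k (yes _)   = Y.≈-refl
        pick-∈ k (no  k∉A) = contradiction (value-∈ k) k∉A

        pick-∉ : ∀ {c} → c ∉ A → ∀ p → pick c p ≡ copy (suc (index c))
        pick-∉ c∉A (yes c∈A) = contradiction c∈A c∉A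
        pick-∉ c∉A (no  _)   = refl

        module _ (γ-block : ∀ k {c} → c Y.∈supp at γ k → block n c ≡ 0) where

          -- Unless both names lie in `A`, a shared name would lie in two different blocks.
          pick-disjoint : ∀ {c d} → c ≢ d → ∀ p q → pick c p Y.# pick d q
          pick-disjoint c≢d (yes c∈A) (yes d∈A) = disjoint γ (c≢d ∘ cong value)
          pick-disjoint {d = d} c≢d (yes c∈A) (no  d∉A) e (e∈c , e∈d) =
            ℕ.0≢1+n (trans (sym (γ-block _ e∈c)) (copy-block (suc (index d)) e∈d))
          pick-disjoint {c} c≢d (no  c∉A) (yes d∈A) e (e∈c , e∈d) =
            ℕ.0≢1+n (trans (sym (γ-block _ e∈d)) (copy-block (suc (index c)) e∈c))
          pick-disjoint {c} {d} c≢d (no  c∉A) (no  d∉A) e (e∈c , e∈d) = c≢d (index-injective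
            (ℕ.suc-injective (trans
              (sym (copy-block (suc (index c)) e∈c))
              (copy-block (suc (index d)) e∈d))))

          extend : Family Y 𝔸
          extend = record
            { at       = λ c → pick c (c ∈? A)
            ; disjoint = λ {c} {d} c≢d → pick-disjoint c≢d (c ∈? A) (d ∈? A)
            }

          extend-∈ : ∀ k → at extend (value k) Y.≈ at γ k
          extend-∈ k = pick-∈ k (value k ∈? A)

          extend-∉ : ∀ {c} → c ∉ A → at extend c ≡ copy (suc (index c))
          extend-∉ {c} c∉A = pick-∉ c∉A (c ∈? A)

    supportOf : Family Y (El A) → List 𝔸
    supportOf {A} γ = proj₁ (^*-finitelySupported Y A γ)

    ∈supportOf : (γ : Family Y (El A)) → ∀ k {c} → c Y.∈supp at γ k → c ∈ supportOf γ
    ∈supportOf {A} γ k c∈ = c∈ _ λ π fix → proj₂ (^*-finitelySupported Y A γ) π fix k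

  abstract

    -- Off `A` an extension depends only on `y₀` and the block length. One length that bounds the
    -- supports of both families therefore makes the two extensions coincide there.
    commonExtension : (Y : NominalSet a) → NominalSet.Carrier Y → (γ δ : Family Y (El A)) →
      let open NominalSet Y in
      Σ[ γ̂ ∈ Family Y 𝔸 ] Σ[ δ̂ ∈ Family Y 𝔸 ]
        (∀ k → at γ̂ (value k) ≈ at γ k) × (∀ k → at δ̂ (value k) ≈ at δ k) ×
        (∀ {c} → c ∉ A → at γ̂ c ≡ at δ̂ c)
    commonExtension Y y₀ γ δ =
        extend γ γ-block , extend δ δ-block , extend-∈ γ γ-block , extend-∈ δ δ-block
      , λ c∉A → trans (extend-∉ γ γ-block c∉A) (sym (extend-∉ δ δ-block c∉A))
      where
      module Y = NominalSet Y
      S : List 𝔸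
      S = supportOf Y γ ++ supportOf Y δ ++ proj₁ (Y.finitelySupported y₀)
      y₀-block : ∀ {c} → c ∈ proj₁ (Y.finitelySupported y₀) → block (bound S) c ≡ 0
      y₀-block c∈ = block-zero S (∈-++⁺ʳ (supportOf Y γ) (∈-++⁺ʳ (supportOf Y δ) c∈))
      open Extend Y y₀ (bound S) y₀-block
      γ-block : ∀ k {c} → c Y.∈supp at γ k → block (bound S) c ≡ 0
      γ-block k c∈ = block-zero S (∈-++⁺ˡ (∈supportOf Y γ k c∈))
      δ-block : ∀ k {c} → c Y.∈supp at δ k → block (bound S) c ≡ 0
      δ-block k c∈ = block-zero S (∈-++⁺ʳ (supportOf Y γ) (∈-++⁺ˡ (∈supportOf Y δ k c∈)))

    -- The permutation realises on A ++ B the inclusion of A, extended to all names.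
    moveOff : ∀ A B → Σ[ π ∈ FinPerm ]
              (∀ {c} → c ∈ A → π ⟨ c ⟩ ≡ c) ×
              (∀ {c} → c ∈ A ++ B → c ∉ A → π ⟨ c ⟩ ∉ A ++ B)
    moveOff A B = π , π-fix , π-away
      where
      C : List 𝔸
      C = A ++ B
      -- The extension is now carried out in `Names`, with `name 0` as `y₀`; `D` puts its support
      -- and all of `C` into block 0.
      D : List 𝔸
      D = name 0 ∷ C
      name0-block : ∀ {c} → c ∈ name 0 ∷ [] → block (bound D) c ≡ 0
      name0-block (here refl) = block-zero D (here refl)
      open Extend Names (name 0) (bound D) name0-block
      ι-block : ∀ k {c} → c ∈suppName at (ι A) k → block (bound D) c ≡ 0
      ι-block k c∈ = block-zero D (there (∈-++⁺ˡ
        (subst (_∈ A) (sym (∈supp-name⁻ c∈)) (value-∈ k))))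
      j : Family Names 𝔸
      j = extend (ι A) ι-block
      moves : Σ[ π ∈ FinPerm ] (∀ {c} → c ∈ C → π ⟨ c ⟩ ≡ at j c)
      moves = extend-injection (↣-id 𝔸) (family⇒injection _≟_ j) C
      π : FinPerm
      π = proj₁ moves
      π-fix : ∀ {c} → c ∈ A → π ⟨ c ⟩ ≡ c
      π-fix {c} c∈A = trans (proj₂ moves (∈-++⁺ˡ c∈A))
        (extend-∈ (ι A) ι-block (c Refinement., Irrelevant.pure c∈A))
      π-away : ∀ {c} → c ∈ C → c ∉ A → π ⟨ c ⟩ ∉ C
      -- All of `C` lies in block 0, whereas `c` is sent to a copy of `name 0` in a later block.
      π-away {c} c∈C c∉A πc∈C = ℕ.0≢1+n (trans (sym (block-zero D (there πc∈C))) πc-block)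
        where
        πc≡copy : π ⟨ c ⟩ ≡ copy (suc (index c))
        πc≡copy = trans (proj₂ moves c∈C) (extend-∉ (ι A) ι-block c∉A)
        πc-block : block (bound D) (π ⟨ c ⟩) ≡ suc (index c)
        πc-block = copy-block (suc (index c)) {π ⟨ c ⟩}
          (subst (π ⟨ c ⟩ ∈suppName_) πc≡copy (∈supp-name (π ⟨ c ⟩)))

  -- Locality of elements of the internal hom on their supports.

  module _ (Y Z : NominalSet a) (y₀ : NominalSet.Carrier Y) where
    private
      module Y = NominalSet Y
      module Z = NominalSet Z
      module [Y,Z] = NominalSet [ Y , Z ]◇

    infix 4 _≈[_]_
    _≈[_]_ : Family Y 𝔸 → List 𝔸 → Family Y 𝔸 → Set _
    γ ≈[ A ] δ = ∀ k → at γ (value {P = _∈ A} k) Y.≈ at δ (value k)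

    -- A reducing set B need not lie in A. Both γ and δ are equal on A ∪ B to extensions γ̂, δ̂ that
    -- coincide off A ∪ B. Composing these with a permutation that fixes A and moves B ∖ A off
    -- A ∪ B makes them equal on all of B, and f does not see the permutation since A supports f.
    supported⇒local : (F : [Y,Z].Carrier) → [Y,Z].Supports A F →
                          ∀ {γ δ} → γ ≈[ A ] δ → ⟦ proj₁ F ⟧ γ Z.≈ ⟦ proj₁ F ⟧ δ
    supported⇒local {A} (f , B , g , f≈g) supp {γ} {δ} γ≈δ = begin
      ⟦ f ⟧ γ         ≈⟨ local (λ k → Y.≈-sym (γ̂≈γ (weaken k))) ⟩
      ⟦ f ⟧ γ̂        ≈⟨ supp π (λ _ → π-fix) γ̂ ⟨
      ⟦ f ⟧ (γ̂ ∘π)   ≈⟨ local (λ k → agree (weaken k) (value k ∈? A)) ⟩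
      ⟦ f ⟧ (δ̂ ∘π)   ≈⟨ supp π (λ _ → π-fix) δ̂ ⟩
      ⟦ f ⟧ δ̂        ≈⟨ local (λ k → δ̂≈δ (weaken k)) ⟩
      ⟦ f ⟧ δ         ∎
      where
      open SetoidReasoning Z.setoid
      C : List 𝔸
      C = A ++ B
      weaken : El B → El C
      weaken = Injection.to (weakenʳ {A = A})

      local : ∀ {φ ψ} → φ ≈[ B ] ψ → ⟦ f ⟧ φ Z.≈ ⟦ f ⟧ ψ
      local {φ} {ψ} p = Z.≈-trans (f≈g φ) (Z.≈-trans (Func.cong g p) (Z.≈-sym (f≈g ψ)))

      extensions = commonExtension Y y₀ (⟦ Y ^*ᵢ incl C ⟧ γ) (⟦ Y ^*ᵢ incl C ⟧ δ)
      γ̂ = proj₁ extensions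
      δ̂ = proj₁ (proj₂ extensions)
      γ̂≈γ : γ̂ ≈[ C ] γ
      γ̂≈γ = proj₁ (proj₂ (proj₂ extensions))
      δ̂≈δ : δ̂ ≈[ C ] δ
      δ̂≈δ = proj₁ (proj₂ (proj₂ (proj₂ extensions)))
      γ̂≡δ̂ : ∀ {c} → c ∉ C → at γ̂ c ≡ at δ̂ c
      γ̂≡δ̂ = proj₂ (proj₂ (proj₂ (proj₂ extensions)))

      π = proj₁ (moveOff A B)
      π-fix : ∀ {c} → c ∈ A → π ⟨ c ⟩ ≡ c
      π-fix = proj₁ (proj₂ (moveOff A B))
      π-away : ∀ {c} → c ∈ C → c ∉ A → π ⟨ c ⟩ ∉ C
      π-away = proj₂ (proj₂ (moveOff A B))
      infix 30 _∘π
      _∘π : Family Y 𝔸 → Family Y 𝔸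
      φ ∘π = _∘ₚ_ {Y = Y} φ π

      -- A name in `A` is fixed by `π`, and `γ` and `δ` agree there; any other name of `C` is sent
      -- off `C`, where the extensions coincide.
      agree : ∀ (k : El C) → Dec (value k ∈ A) → at γ̂ (π ⟨ value k ⟩) Y.≈ at δ̂ (π ⟨ value k ⟩)
      agree k (yes k∈A) rewrite π-fix k∈A =
        Y.≈-trans (γ̂≈γ k) (Y.≈-trans (γ≈δ (value k Refinement., Irrelevant.pure k∈A))
          (Y.≈-sym (δ̂≈δ k)))
      agree k (no k∉A) =
        Setoid.reflexive Y.setoid (γ̂≡δ̂ (π-away (value-∈ k) k∉A))

    total : Family Y (El A) → Family Y 𝔸
    total γ = proj₁ (commonExtension Y y₀ γ γ)

    total-∈ : (γ : Family Y (El A)) → ∀ k → at (total γ) (value k) Y.≈ at γ k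
    total-∈ γ = proj₁ (proj₂ (proj₂ (commonExtension Y y₀ γ γ)))

  -- The inverse transpose.

  module _ (X Y Z : NominalSet a) (y₀ : NominalSet.Carrier Y) where
    private
      module X = NominalSet X
      module Y = NominalSet Y
      module Z = NominalSet Z
      module X◇Y = NominalSet (X ◇ Y)
    open Tensor X Y using (∐; _⟶_; resp; glide)

    -- Each element of the tensor has the form `(A , f , restrict X Y γ̂ A)` with `γ̂` defined on
    -- all names, and there `h` is computed by its transpose.
    curry-injective : (h k : permSet (X ◇ Y) ⇒ permSet Z) →
                      (∀ x γ → eval X Y Z h x γ Z.≈ eval X Y Z k x γ) →
                      ∀ t → ⟦ h ⟧ t Z.≈ ⟦ k ⟧ t
    curry-injective h k p (A , f , γ) = begin
      ⟦ h ⟧ (A , f , γ)                ≈⟨ ⟦⟧-cong h restrict-total ⟩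
      ⟦ h ⟧ (A , f , restrict X Y γ̂ A) ≈⟨ eval-at X Y Z h f γ̂ X.≈-refl ⟨
      eval X Y Z h (⟦ f ⟧ (ι A)) γ̂    ≈⟨ p (⟦ f ⟧ (ι A)) γ̂ ⟩
      eval X Y Z k (⟦ f ⟧ (ι A)) γ̂    ≈⟨ eval-at X Y Z k f γ̂ X.≈-refl ⟩
      ⟦ k ⟧ (A , f , restrict X Y γ̂ A) ≈⟨ ⟦⟧-cong k restrict-total ⟨
      ⟦ k ⟧ (A , f , γ)                ∎
      where
      open SetoidReasoning Z.setoid
      γ̂ = total Y Z y₀ γ
      restrict-total : (A , f , γ) X◇Y.≈ (A , f , restrict X Y γ̂ A)
      restrict-total = Tensor.byResp X Y (λ l → Y.≈-sym (total-∈ Y Z y₀ γ l))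

    module _ (F : permSet X ⇒ permSet [ Y , Z ]◇) where

      apply : X.Carrier → Family Y 𝔸 → Z.Carrier
      apply x = ⟦ proj₁ (⟦ F ⟧ x) ⟧

      apply-local : ∀ {x} → X.Supports A x → ∀ γ δ →
                    (∀ (k : El A) → at γ (value k) Y.≈ at δ (value k)) → apply x γ Z.≈ apply x δ
      apply-local {x = x} supp γ δ =
        supported⇒local Y Z y₀ (⟦ F ⟧ x) (supports-⟦⟧ F supp) {γ} {δ}

      pairing : ∐ → Z.Carrier
      pairing (A , f , γ) = apply (⟦ f ⟧ (ι A)) (total Y Z y₀ γ)

      ι-supp : (f : Names ^* El A ⇒ X.permSet) → X.Supports A (⟦ f ⟧ (ι A))
      ι-supp {A} f = supports-⟦⟧ f {x = ι A} (ι-supported A)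

      -- By locality, any extension `δ` of `γ` may replace the arbitrary choice `total`.
      pairing-≈ : (f : Names ^* El A ⇒ X.permSet) (γ : Family Y (El A)) (δ : Family Y 𝔸) →
                  (∀ k → at γ k Y.≈ at δ (value k)) →
                  pairing (A , f , γ) Z.≈ apply (⟦ f ⟧ (ι A)) δ
      pairing-≈ f γ δ p = apply-local (ι-supp f) (total Y Z y₀ γ) δ
        λ k → Y.≈-trans (total-∈ Y Z y₀ γ k) (p k)

      pairing-resp : ∀ {s t} → s ⟶ t → pairing s Z.≈ pairing t
      pairing-resp (resp {A} {f} {f′} {γ} {γ′} p q) = Z.≈-trans
        (pairing-≈ f γ (total Y Z y₀ γ′) λ k → Y.≈-trans (q k) (Y.≈-sym (total-∈ Y Z y₀ γ′ k)))
        (⟦⟧-cong F (p (ι A)) (total Y Z y₀ γ′))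
      -- With `π` a finite permutation extending `i`, the family `γ̂π` extends `γ` composed with
      -- `i`, and equivariance of `F` moves `π` from the family to `⟦ f ⟧ (ι A)`.
      pairing-resp (glide {A} {B} i f γ) = begin
        pairing (A , f , ⟦ Y ^*ᵢ i ⟧ γ) ≈⟨ pairing-≈ f (⟦ Y ^*ᵢ i ⟧ γ) (_∘ₚ_ {Y = Y} γ̂ π) γ-π ⟩
        apply (⟦ f ⟧ (ι A)) (_∘ₚ_ {Y = Y} γ̂ π) ≈⟨ equivariant F π (⟦ f ⟧ (ι A)) γ̂ ⟨
        apply (π X.· ⟦ f ⟧ (ι A)) γ̂ ≈⟨ ⟦⟧-cong F (at-ι X.permSet f π {iB} (realise-at iB)) γ̂ ⟨
        pairing (B , f ⊚ Names ^*ᵢ i , γ) ∎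
        where
        open SetoidReasoning Z.setoid
        γ̂ = total Y Z y₀ γ
        iB = ⟦ Names ^*ᵢ i ⟧ (ι B)
        π = realise iB
        γ-π : ∀ k → at γ (Injection.to i k) Y.≈ at γ̂ (π ⟨ value k ⟩)
        γ-π k = Y.≈-trans (Y.≈-sym (total-∈ Y Z y₀ γ (Injection.to i k)))
          (Setoid.reflexive Y.setoid (cong (at γ̂) (sym (realise-at iB k))))

      uncurry : permSet (X ◇ Y) ⇒ permSet Z
      uncurry = record
        { func = record
            { to   = pairing
            ; cong = EqC.gfold Z.isEquivalence pairing pairing-resp
            }
        -- Translating the extension of `γ` by `π` gives an extension of `π · γ`, and the values of
        -- `F` are themselves equivariant.
        ; equivariant = λ { π (A , f , γ) → Z.≈-trans
            (pairing-≈ f (PermSet._·_ (Y ^* El A) π γ) (PermSet._·_ (Y ^* 𝔸) π (total Y Z y₀ γ))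
              (λ k → Y.·-congʳ π (Y.≈-sym (total-∈ Y Z y₀ γ k))))
            (equivariant (proj₁ (⟦ F ⟧ (⟦ f ⟧ (ι A)))) π (total Y Z y₀ γ)) }
        }

      -- `γ` is itself an extension of its restriction to the support of `x`.
      curry-uncurry : ∀ x γ → eval X Y Z uncurry x γ Z.≈ apply x γ
      curry-uncurry x γ =
        let S , supp = X.finitelySupported x
            f = orbit X.permSet supp
        in Z.≈-trans (pairing-≈ f (restrict X Y γ S) γ (λ _ → Y.≈-refl))
                     (⟦⟧-cong F (orbit-ι X.permSet supp) γ)

theorem6p13 : (𝔸 : Set) (𝔸↔ℕ : 𝔸 ↔ ℕ) (ℓ : Level) →
  let open Nominal 𝔸 𝔸↔ℕ
      open NominalSet using (permSet) in
  Σ[ φ ∈ ((X Y Z : NominalSet ℓ) → Func (Nom (X ◇ Y) Z) (Nom X [ Y , Z ]◇)) ]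
    ((X X′ Y Y′ Z Z′ : NominalSet ℓ)
     (u : permSet X′ ⇒ permSet X) (v : permSet Y′ ⇒ permSet Y) (w : permSet Z ⇒ permSet Z′)
     (h : permSet (X ◇ Y) ⇒ permSet Z) →
     Setoid._≈_ (Nom X′ [ Y′ , Z′ ]◇)
       (Func.to (φ X′ Y′ Z′) (w ⊚ h ⊚ (_◇₁_ {X = X′} {X} {Y′} {Y} u v)))
       ([_,_]₁ {Y = Y} {Y′} {Z} {Z′} v w ⊚ Func.to (φ X Y Z) h ⊚ u))
    ×
    ((X Y Z : NominalSet ℓ) → Inhabited Y →
     Bijective (Setoid._≈_ (Nom (X ◇ Y) Z)) (Setoid._≈_ (Nom X [ Y , Z ]◇))
       (Func.to (φ X Y Z)))
theorem6p13 𝔸 𝔸↔ℕ ℓ =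
    curryFunc
  , curry-natural
  , λ X Y Z y₀ →
      (λ {h} {k} → curry-injective X Y Z y₀ h k)
    -- Surjectivity concerns every `h` equal to the preimage, whence the first step `p _`.
    , λ F → uncurry X Y Z y₀ F , λ {h} p x γ → NominalSet.≈-trans Z
        (p _) (curry-uncurry X Y Z y₀ F x γ)
  where
  open Nominal 𝔸 𝔸↔ℕ
  open Adjunction 𝔸 𝔸↔ℕ
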